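{- For any $k\ge 1$, the generating function $G_k(x)=\sum_n g_{k,n}x^n$ that counts Greek key tours with height $k$ is rational.
   Context: A Greek key tour on the $k\times n$ grid graph ($k$ rows, $n$ columns; vertices are integer points, edges join points at distance $1$) is a directed self-avoiding walk that starts at the upper-left corner vertex and visits every vertex of the grid exactly once. $g_{k,n}$ denotes the number of Greek key tours on the $k\times n$ grid graph, with the convention $g_{k,0}=1$. "Rational" means that the formal power series equals a quotient of two polynomials. -}

module Defs where

open import Data.Nat using (ℕ; zero; suc; _+_; _*_; _∸_; _^_; ∣_-_∣; NonZero)
import Data.Nat as ℕ
open import Data.Fin using (Fin; zero; suc; toℕ)
import Data.Fin.Properties as Fin
open import Data.Integer using (+_)
open import Data.Rational as ℚ using (ℚ; 0ℚ)
open import Data.Rational.Properties using (+-0-commutativeMonoid)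
open import Algebra.Properties.CommutativeMonoid.Sum +-0-commutativeMonoid using (sum)
open import Data.List using
  (List; []; _∷_; head; length; filter; map; allFin; cartesianProduct; cartesianProductWith)
open import Data.List.Properties using (length-++; length-map; length-tabulate; ∷-injective)
open import Data.List.Membership.Propositional using (_∈_)
open import Data.List.Membership.Propositional.Properties using
  (∈-allFin; ∈-cartesianProduct⁺; ∈-cartesianProductWith⁺; ∈-filter⁺; ∈-filter⁻)
import Data.List.Membership.DecPropositional as DecMembership
open import Data.List.Membership.Propositional.Properties.WithK using (unique∧set⇒bag)
open import Data.List.Relation.Binary.BagAndSetEquality using (∼bag⇒↭)
open import Data.List.Relation.Binary.Permutation.Propositional.Properties using (↭-length)
open import Data.List.Relation.Unary.Any using (here)
import Data.List.Relation.Unary.All as All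
import Data.List.Relation.Unary.AllPairs as AllPairs
open import Data.List.Relation.Unary.Linked using (Linked; linked?)
open import Data.List.Relation.Unary.Unique.Propositional using (Unique)
import Data.List.Relation.Unary.Unique.Propositional.Properties as Unique
import Data.List.Relation.Unary.Unique.DecPropositional as DecUnique
open import Data.Maybe using (just)
import Data.Maybe.Properties as Maybe
open import Data.Product using (∃₂; _×_; _,_; proj₂; uncurry)
import Data.Product.Properties as Product
open import Function using (_⇔_; mk⇔)
open import Relation.Nullary using (¬_)
open import Relation.Nullary.Decidable using (_×-dec_; map′)
open import Relation.Unary using (Decidable)
open import Relation.Binary.Definitions using (DecidableEquality)
open import Relation.Binary.PropositionalEquality using (_≡_; _≗_; refl; trans; cong₂; subst)

-- (row , column), with rows numbered downwards and columns rightwards,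
-- so that (0 , 0) is the upper-left corner.
Vertex : ℕ → ℕ → Set
Vertex k n = Fin k × Fin n

corner : ∀ {k n} .{{_ : NonZero k}} .{{_ : NonZero n}} → Vertex k n
corner {suc _} {suc _} = zero , zero

-- The Euclidean distance is 1 exactly when its square is.
Adjacent : ∀ {k n} → Vertex k n → Vertex k n → Set
Adjacent (r , c) (r′ , c′) = ∣ toℕ r - toℕ r′ ∣ ^ 2 + ∣ toℕ c - toℕ c′ ∣ ^ 2 ≡ 1

record IsGreekKeyTour {k n : ℕ} .{{_ : NonZero k}} .{{_ : NonZero n}}
                      (w : List (Vertex k n)) : Set where
  constructor isGreekKeyTour
  field
    startsAtCorner : head w ≡ just corner
    walk           : Linked Adjacent w
    selfAvoiding   : Unique w
    visitsAll      : ∀ v → v ∈ w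

_≟ᵛ_ : ∀ {k n} → DecidableEquality (Vertex k n)
_≟ᵛ_ = Product.≡-dec Fin._≟_ Fin._≟_

isGreekKeyTour? : ∀ {k n} .{{_ : NonZero k}} .{{_ : NonZero n}} →
                  Decidable (IsGreekKeyTour {k} {n})
isGreekKeyTour? w =
  map′ (λ (s , l , u , a) → isGreekKeyTour s l u (uncurry a))
       (λ (isGreekKeyTour s l u a) → s , l , u , λ r c → a (r , c))
       (Maybe.≡-dec _≟ᵛ_ (head w) (just corner)
         ×-dec linked? (λ _ _ → _ ℕ.≟ _) w
         ×-dec DecUnique.unique? _≟ᵛ_ w
         ×-dec Fin.all? (λ r → Fin.all? (λ c → DecMembership._∈?_ _≟ᵛ_ (r , c) w)))

vertices : ∀ k n → List (Vertex k n)
vertices k n = cartesianProduct (allFin k) (allFin n)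

words : ∀ {A : Set} → List A → ℕ → List (List A)
words xs zero    = [] ∷ []
words xs (suc m) = cartesianProductWith _∷_ xs (words xs m)

-- Restricting to words of length k * n loses no tour: see ∈-greekKeyTours.
greekKeyTours : ∀ k n .{{_ : NonZero k}} .{{_ : NonZero n}} → List (List (Vertex k n))
greekKeyTours k n = filter isGreekKeyTour? (words (vertices k n) (k * n))

g : ∀ k .{{_ : NonZero k}} → ℕ → ℕ
g k zero      = 1
g k n@(suc _) = length (greekKeyTours k n)

PowerSeries : Set
PowerSeries = ℕ → ℚ

-- Coefficients in increasing degree; trailing zeros are allowed.
Polynomial : Set
Polynomial = List ℚ

⟦_⟧ : Polynomial → PowerSeries
⟦ []    ⟧ _       = 0ℚ
⟦ a ∷ p ⟧ zero    = a
⟦ a ∷ p ⟧ (suc i) = ⟦ p ⟧ i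

infixl 7 _⊛_
_⊛_ : PowerSeries → PowerSeries → PowerSeries
(f ⊛ h) n = sum {suc n} (λ i → f (toℕ i) ℚ.* h (n ∸ toℕ i))

-- f = p / q with q ≠ 0.
IsRational : PowerSeries → Set
IsRational f = ∃₂ λ (p q : Polynomial) → ¬ (⟦ q ⟧ ≗ ⟦ [] ⟧) × (⟦ q ⟧ ⊛ f ≗ ⟦ p ⟧)

G : ∀ k .{{_ : NonZero k}} → PowerSeries
G k n = + g k n ℚ./ 1

-- greekKeyTours lists every Greek key tour exactly once, so its length is
-- the number of tours.

∈-vertices : ∀ {k n} (v : Vertex k n) → v ∈ vertices k n
∈-vertices (r , c) = ∈-cartesianProduct⁺ (∈-allFin r) (∈-allFin c)

vertices-unique : ∀ k n → Unique (vertices k n)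
vertices-unique k n = Unique.cartesianProduct⁺ (Unique.allFin⁺ k) (Unique.allFin⁺ n)

length-cartesianProduct : ∀ {A B : Set} (xs : List A) (ys : List B) →
                          length (cartesianProduct xs ys) ≡ length xs * length ys
length-cartesianProduct []       ys = refl
length-cartesianProduct (x ∷ xs) ys =
  trans (length-++ (map (x ,_) ys))
        (cong₂ _+_ (length-map (x ,_) ys) (length-cartesianProduct xs ys))

length-vertices : ∀ k n → length (vertices k n) ≡ k * n
length-vertices k n =
  trans (length-cartesianProduct (allFin k) (allFin n))
        (cong₂ _*_ (length-tabulate {n = k} (λ i → i)) (length-tabulate {n = n} (λ i → i)))

∈-words : ∀ {A : Set} {xs : List A} → (∀ x → x ∈ xs) → ∀ w → w ∈ words xs (length w)
∈-words all []      = here refl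
∈-words all (x ∷ w) = ∈-cartesianProductWith⁺ _∷_ (all x) (∈-words all w)

words-unique : ∀ {A : Set} {xs : List A} → Unique xs → ∀ m → Unique (words xs m)
words-unique u zero    = All.[] AllPairs.∷ AllPairs.[]
words-unique u (suc m) = Unique.cartesianProductWith⁺ _∷_ ∷-injective u (words-unique u m)

module _ {k n : ℕ} .{{_ : NonZero k}} .{{_ : NonZero n}} where

  length-tour : {w : List (Vertex k n)} → IsGreekKeyTour w → length w ≡ k * n
  length-tour t = trans
    (↭-length (∼bag⇒↭ (unique∧set⇒bag selfAvoiding (vertices-unique k n)
      (λ {v} → mk⇔ (λ _ → ∈-vertices v) (λ _ → visitsAll v)))))
    (length-vertices k n)
    where open IsGreekKeyTour t

  ∈-greekKeyTours : {w : List (Vertex k n)} → w ∈ greekKeyTours k n ⇔ IsGreekKeyTour w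
  ∈-greekKeyTours {w} = mk⇔
    (λ w∈ → proj₂ (∈-filter⁻ isGreekKeyTour? {xs = words (vertices k n) (k * n)} w∈))
    (λ t → ∈-filter⁺ isGreekKeyTour?
      (subst (λ m → w ∈ words (vertices k n) m) (length-tour t) (∈-words ∈-vertices w)) t)

  greekKeyTours-unique : Unique (greekKeyTours k n)
  greekKeyTours-unique =
    Unique.filter⁺ isGreekKeyTour? (words-unique (vertices-unique k n) (k * n))

{-# OPTIONS --safe #-}

-- Cutting off the first column decomposes a tour into alternating pieces inside
-- and outside that column. More generally, consider ordered systems of walks
-- covering the grid whose start rows (and possibly end rows) in the first column
-- are prescribed by an interface: such a system is the same thing as a covering
-- of the first column together with a system, for the interface that this
-- covering induces, on the remaining columns. A height admits finitely many
-- relevant interfaces, so the counting sequences span a finite-dimensional space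
-- closed under the shift f(n) ↦ f(n+1). The shifts of any member are therefore
-- linearly dependent, which is a linear recurrence with constant coefficients.

module Submission where

open import Defs
open import Data.Bool using (if_then_else_)
open import Data.Nat as ℕ using (ℕ; zero; suc; _<_; _≤_; s≤s; z≤n; NonZero)
import Data.Nat.Properties as ℕ
open import Data.Fin using (Fin; zero; suc; toℕ)
import Data.Fin.Properties as Fin
open import Data.Integer as ℤ using (+_)
import Data.Integer.Properties as ℤ
open import Data.Rational as ℚ using (0ℚ; 1ℚ; _+_; _*_; -_; 1/_; _/_)
import Data.Rational.Properties as ℚ
open import Data.Rational.Solver using (module +-*-Solver)
import Data.Rational.Unnormalised as ℚᵘ
import Data.Rational.Unnormalised.Properties as ℚᵘ
open import Data.List using
  (List; []; _∷_; _++_; _∷ʳ_; length; map; filter; concatMap; catMaybes; allFin; upTo;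
   cartesianProduct)
import Data.List.Properties as List
open import Data.List.Membership.Propositional using (_∈_; _∉_)
open import Data.List.Membership.Propositional.Properties using
  (∈-map⁺; ∈-map⁻; ∈-concat⁺′; ∈-concat⁻′; ∈-filter⁺; ∈-filter⁻; ∈-cartesianProduct⁺;
   ∈-allFin; ∈-upTo⁺)
open import Data.List.Membership.Propositional.Properties.WithK using (unique∧set⇒bag)
open import Data.List.Relation.Binary.BagAndSetEquality using (∼bag⇒↭)
open import Data.List.Relation.Binary.Permutation.Propositional.Properties using (↭-length)
open import Data.List.Relation.Unary.All as All using (All; []; _∷_)
import Data.List.Relation.Unary.All.Properties as All
open import Data.List.Relation.Unary.AllPairs using ([]; _∷_)
open import Data.List.Relation.Unary.Any using (here; there)
open import Data.List.Relation.Unary.Linked using (Linked; [-]; _∷_)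
open import Data.List.Relation.Unary.Unique.Propositional using (Unique)
import Data.List.Relation.Unary.Unique.Propositional.Properties as Unique
open import Data.Maybe as Maybe using (Maybe; just; nothing; fromMaybe)
import Data.Maybe.Properties as Maybe
open import Data.Product using (∃; ∃₂; _×_; _,_; proj₁; proj₂)
open import Data.Sum using (_⊎_; inj₁; inj₂)
open import Data.Empty using (⊥)
open import Function using (_⇔_; mk⇔; _∘_; Equivalence)
open import Relation.Nullary using (Dec; yes; no; does; ¬_; contradiction)
open import Relation.Nullary.Decidable using
  (map′; _×-dec_; _⊎-dec_; does-⇔; dec-false; dec-true)
open import Relation.Binary.Definitions using (DecidableEquality)
open import Relation.Binary.PropositionalEquality using
  (_≡_; _≢_; _≗_; refl; sym; trans; cong; cong₂; subst; module ≡-Reasoning)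
open +-*-Solver using (solve; _:=_; con; _:+_; _:*_; :-_)

-- Shift-closed finite-dimensional spaces of sequences

shift : PowerSeries → PowerSeries
shift f n = f (suc n)

-- The pointwise equations in `null` and `comb` make the span invariant under pointwise equality of
-- sequences.
data Span (B : List PowerSeries) : PowerSeries → Set where
  gen  : ∀ {f} → f ∈ B → Span B f
  null : ∀ {h} → (∀ n → h n ≡ 0ℚ) → Span B h
  comb : ∀ {f₁ f₂ h} a → Span B f₁ → Span B f₂ →
         (∀ n → h n ≡ f₁ n + a * f₂ n) → Span B h

bind : ∀ {B C h} → (∀ {f} → f ∈ B → Span C f) → Span B h → Span C h
bind σ (gen f∈)        = σ f∈
bind σ (null z)        = null z
bind σ (comb a s₁ s₂ e) = comb a (bind σ s₁) (bind σ s₂) e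

weaken : ∀ {B f h} → Span B h → Span (f ∷ B) h
weaken = bind (λ f∈ → gen (there f∈))

span-resp : ∀ {B f h} → Span B f → (∀ n → h n ≡ f n) → Span B h
span-resp {f = f} s e = comb 0ℚ s s (λ n →
  trans (e n) (solve 1 (λ x → x := x :+ con 0ℚ :* x) refl (f n)))

scale : ∀ {B f} a → Span B f → Span B (λ n → a * f n)
scale a s = comb a (null (λ _ → refl)) s (λ n → sym (ℚ.+-identityˡ _))

-- The coefficient of `f` is read off the derivation, so it is a choice rather than an invariant
-- when `f` itself depends on `B`.
coordinate : ∀ {B f h} → Span (f ∷ B) h →
             ∃₂ λ a r → Span B r × (∀ n → h n ≡ a * f n + r n)
coordinate {f = f} (gen (here refl)) = 1ℚ , (λ _ → 0ℚ) , null (λ _ → refl) ,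
  λ n → solve 1 (λ x → x := con 1ℚ :* x :+ con 0ℚ) refl (f n)
coordinate {f = f} {h} (gen (there h∈)) = 0ℚ , h , gen h∈ ,
  λ n → solve 2 (λ x y → y := con 0ℚ :* x :+ y) refl (f n) (h n)
coordinate {f = f} (null z) = 0ℚ , (λ _ → 0ℚ) , null (λ _ → refl) ,
  λ n → trans (z n) (solve 1 (λ x → con 0ℚ := con 0ℚ :* x :+ con 0ℚ) refl (f n))
coordinate {f = f} (comb a s₁ s₂ e) with coordinate s₁ | coordinate s₂
... | a₁ , r₁ , t₁ , e₁ | a₂ , r₂ , t₂ , e₂ =
  a₁ + a * a₂ , (λ n → r₁ n + a * r₂ n) , comb a t₁ t₂ (λ _ → refl) , λ n →
  trans (e n) (trans (cong₂ (λ x y → x + a * y) (e₁ n) (e₂ n))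
    (solve 6 (λ a a₁ a₂ x r₁ r₂ → a₁ :* x :+ r₁ :+ a :* (a₂ :* x :+ r₂) :=
                                  (a₁ :+ a :* a₂) :* x :+ (r₁ :+ a :* r₂)) refl
       a a₁ a₂ (f n) (r₁ n) (r₂ n)))

span-[] : ∀ {h} → Span [] h → ∀ n → h n ≡ 0ℚ
span-[] (null z) n = z n
span-[] (comb a s₁ s₂ e) n =
  trans (e n) (trans (cong₂ (λ x y → x + a * y) (span-[] s₁ n) (span-[] s₂ n))
    (solve 1 (λ a → con 0ℚ :+ a :* con 0ℚ := con 0ℚ) refl a))

-- Singling out a member that depends on those after it normalises its coefficient to 1. For
-- `shifts`, where the highest shift comes first, this is already a monic recurrence.
Dependent : List PowerSeries → Set
Dependent []       = ⊥
Dependent (h ∷ hs) = Span hs h ⊎ Dependent hs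

-- One step of Gaussian elimination on hs ⊆ Span (f ∷ B): either f is not
-- involved, or f lies in Span hs + Span B and one member of hs can be traded
-- for this fact.
record Eliminated (f : PowerSeries) (B hs : List PowerSeries) : Set where
  field
    rest         : List PowerSeries
    shorter      : length hs ≡ suc (length rest)
    rest⊆        : All (Span B) rest
    rest-span    : ∀ {h} → Span rest h → Span hs h
    rest-dep     : Dependent rest → Dependent hs
    {pivot tail} : PowerSeries
    pivot∈       : Span hs pivot
    tail∈        : Span B tail
    f≗           : ∀ n → f n ≡ pivot n + tail n

-- The pivot is a multiple of the last member of `hs` whose coefficient of `f` is nonzero. That
-- member is dropped, later ones stay as they are, and earlier ones have a multiple of the pivot
-- subtracted.
eliminate : ∀ {f B} hs → All (Span (f ∷ B)) hs → All (Span B) hs ⊎ Eliminated f B hs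
eliminate [] [] = inj₁ []
eliminate {f} (h ∷ hs) (s ∷ ss) with coordinate s | eliminate hs ss
... | a , r , t , e | inj₁ ts with a ℚ.≟ 0ℚ
...   | yes refl = inj₁ (span-resp t (λ n → trans (e n)
          (solve 2 (λ x r → con 0ℚ :* x :+ r := r) refl (f n) (r n))) ∷ ts)
...   | no a≢0 = inj₂ record
          { rest = hs ; shorter = refl ; rest⊆ = ts ; rest-span = weaken ; rest-dep = inj₂
          ; pivot∈ = scale a⁻¹ (gen (here refl))
          ; tail∈ = scale (- a⁻¹) t
          ; f≗ = λ n → sym (begin
              a⁻¹ * h n + - a⁻¹ * r n
                ≡⟨ cong (λ x → a⁻¹ * x + - a⁻¹ * r n) (e n) ⟩
              a⁻¹ * (a * f n + r n) + - a⁻¹ * r n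
                ≡⟨ solve 4 (λ b a x r → b :* (a :* x :+ r) :+ :- b :* r := b :* a :* x) refl
                     a⁻¹ a (f n) (r n) ⟩
              a⁻¹ * a * f n
                ≡⟨ cong (_* f n) (ℚ.*-inverseˡ a) ⟩
              1ℚ * f n
                ≡⟨ ℚ.*-identityˡ (f n) ⟩
              f n ∎) }
  where
  open ≡-Reasoning
  instance _ = ℚ.≢-nonZero a≢0
  a⁻¹ = 1/ a
eliminate {f} (h ∷ hs) (s ∷ ss) | a , r , t , e | inj₂ E = inj₂ record
  { rest = h′ ∷ rest ; shorter = cong suc shorter
  ; rest⊆ = comb a t tail∈ (λ n →
      trans (cong₂ (λ x y → x + - a * y) (e n) refl)
      (trans (cong (λ x → a * x + r n + - a * pivot n) (f≗ n))
        (solve 4 (λ a p q r → a :* (p :+ q) :+ r :+ :- a :* p := r :+ a :* q) refl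
          a (pivot n) (tail n) (r n)))) ∷ rest⊆
  ; rest-span = bind λ
      { (here refl) → comb (- a) (gen (here refl)) (weaken pivot∈) (λ _ → refl)
      ; (there x∈)  → weaken (rest-span (gen x∈)) }
  -- The pivot lies in the span of the members after `h`, so it can be added back to a relation for
  -- `h′`.
  ; rest-dep = λ
      { (inj₁ d) → inj₁ (comb a (rest-span d) pivot∈ (λ n →
          solve 3 (λ a h p → h := h :+ :- a :* p :+ a :* p) refl a (h n) (pivot n)))
      ; (inj₂ d) → inj₂ (rest-dep d) }
  ; pivot∈ = weaken pivot∈ ; tail∈ = tail∈ ; f≗ = f≗ }
  where
  open Eliminated E
  h′ : PowerSeries
  h′ n = h n + - a * pivot n

-- Each elimination removes one generator and at most one vector, so the strict inequality survives
-- until no generator is left; a vector is then still present, and it is zero.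
dependent : ∀ B {hs} → All (Span B) hs → length B < length hs → Dependent hs
dependent [] (s ∷ _) _ = inj₁ (null (span-[] s))
dependent (f ∷ B) {hs} ss B<hs with eliminate hs ss
... | inj₁ ts = dependent B ts (ℕ.<-trans (ℕ.n<1+n _) B<hs)
... | inj₂ E  = rest-dep (dependent B rest⊆ (ℕ.s<s⁻¹ (subst (suc (length B) <_) shorter B<hs)))
  where open Eliminated E

-- Linear recurrences and rational generating functions

shifts : PowerSeries → ℕ → List PowerSeries
shifts f zero    = []
shifts f (suc i) = (λ n → f (i ℕ.+ n)) ∷ shifts f i

length-shifts : ∀ f i → length (shifts f i) ≡ i
length-shifts f zero    = refl
length-shifts f (suc i) = cong suc (length-shifts f i)

recurrence : ∀ f i → Dependent (shifts f i) → ∃ λ j → Span (shifts f j) (λ n → f (j ℕ.+ n))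
recurrence f (suc i) (inj₁ s) = i , s
recurrence f (suc i) (inj₂ d) = recurrence f i d

-- Multiplication by the variable of the power series.
delay : PowerSeries → PowerSeries
delay f zero    = 0ℚ
delay f (suc n) = f n

⊛-[] : ∀ f n → (⟦ [] ⟧ ⊛ f) n ≡ 0ℚ
⊛-[] f zero    = solve 1 (λ x → con 0ℚ :* x :+ con 0ℚ := con 0ℚ) refl (f 0)
⊛-[] f (suc n) = trans (cong (λ x → 0ℚ * f (suc n) + x) (⊛-[] f n))
  (solve 1 (λ x → con 0ℚ :* x :+ con 0ℚ := con 0ℚ) refl (f (suc n)))

⊛-∷ : ∀ a q f n → (⟦ a ∷ q ⟧ ⊛ f) n ≡ a * f n + delay (⟦ q ⟧ ⊛ f) n
⊛-∷ a q f zero    = refl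
⊛-∷ a q f (suc n) = refl

-- The list `r` holds the negated coefficients, highest shift first. When `h` is the `i`-th shift of
-- `f`, the polynomial `1ℚ ∷ r` is therefore the reversed characteristic polynomial of the
-- recurrence.
characteristic : ∀ f i {h} → Span (shifts f i) h →
                 ∃ λ r → ∀ n → h n + delay (⟦ r ⟧ ⊛ f) (i ℕ.+ n) ≡ 0ℚ
characteristic f zero s = [] , λ n → cong₂ _+_ (span-[] s n) (delay-0 n)
  where
  delay-0 : ∀ n → delay (⟦ [] ⟧ ⊛ f) n ≡ 0ℚ
  delay-0 zero    = refl
  delay-0 (suc n) = ⊛-[] f n
characteristic f (suc i) {h} s with coordinate s
... | a , h′ , s′ , e with characteristic f i s′
...   | r , z = - a ∷ r , λ n → begin
  h n + (⟦ - a ∷ r ⟧ ⊛ f) (i ℕ.+ n)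
    ≡⟨ cong₂ _+_ (e n) (⊛-∷ (- a) r f (i ℕ.+ n)) ⟩
  a * f (i ℕ.+ n) + h′ n + (- a * f (i ℕ.+ n) + delay (⟦ r ⟧ ⊛ f) (i ℕ.+ n))
    ≡⟨ solve 4 (λ a x y d → a :* x :+ y :+ (:- a :* x :+ d) := y :+ d) refl
         a (f (i ℕ.+ n)) (h′ n) (delay (⟦ r ⟧ ⊛ f) (i ℕ.+ n)) ⟩
  h′ n + delay (⟦ r ⟧ ⊛ f) (i ℕ.+ n)
    ≡⟨ z n ⟩
  0ℚ ∎
  where open ≡-Reasoning

truncation : ∀ i h → (∀ n → h (i ℕ.+ n) ≡ 0ℚ) → ∃ λ p → h ≗ ⟦ p ⟧
truncation zero    h z = [] , z
truncation (suc i) h z with truncation i (shift h) z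
... | p , e = h 0 ∷ p , λ { zero → refl ; (suc n) → e n }

module _ {B : List PowerSeries} (closed : ∀ {f} → f ∈ B → Span B (shift f)) where

  shift-span : ∀ {h} → Span B h → Span B (shift h)
  shift-span (gen f∈)         = closed f∈
  shift-span (null z)         = null (λ n → z (suc n))
  shift-span (comb a s₁ s₂ e) = comb a (shift-span s₁) (shift-span s₂) (λ n → e (suc n))

  shift^-span : ∀ i {h} → Span B h → Span B (λ n → h (i ℕ.+ n))
  shift^-span zero    s = s
  shift^-span (suc i) s = shift^-span i (shift-span s)

  shifts-span : ∀ i {h} → Span B h → All (Span B) (shifts h i)
  shifts-span zero    s = []
  shifts-span (suc i) s = shift^-span i s ∷ shifts-span i s

  shiftClosed⇒rational : ∀ {f} → f ∈ B → IsRational f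
  shiftClosed⇒rational {f} f∈
    -- One shift more than there are generators forces a dependence.
    with recurrence f (suc (length B)) (dependent B (shifts-span (suc (length B)) (gen f∈))
           (ℕ.≤-reflexive (sym (length-shifts f (suc (length B))))))
  ... | i , s with characteristic f i s
  ... | r , z with truncation i (⟦ 1ℚ ∷ r ⟧ ⊛ f) (λ n →
          trans (⊛-∷ 1ℚ r f (i ℕ.+ n))
            (trans (cong (_+ delay (⟦ r ⟧ ⊛ f) (i ℕ.+ n)) (ℚ.*-identityˡ (f (i ℕ.+ n)))) (z n)))
  -- The denominator is nonzero because its constant term is 1; the numerator is the product cut off
  -- at degree `i`, from where on the recurrence makes it vanish.
  ... | p , e = p , 1ℚ ∷ r , (λ q≗0 → ℚ.1≢0 (q≗0 0)) , e

/1-homo-+ : ∀ m n → + (m ℕ.+ n) / 1 ≡ + m / 1 + + n / 1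
/1-homo-+ m n = ℚ.toℚᵘ-injective (begin
  ℚ.toℚᵘ (+ (m ℕ.+ n) / 1)
    ≈⟨ ℚ.toℚᵘ-fromℚᵘ (ι (m ℕ.+ n)) ⟩
  ι (m ℕ.+ n)
    ≈⟨ ℚᵘ.*≡* (cong (ℤ._* + 1)
         (cong₂ ℤ._+_ (sym (ℤ.*-identityʳ (+ m))) (sym (ℤ.*-identityʳ (+ n))))) ⟩
  ι m ℚᵘ.+ ι n
    ≈⟨ ℚᵘ.+-cong (ℚ.toℚᵘ-fromℚᵘ (ι m)) (ℚ.toℚᵘ-fromℚᵘ (ι n)) ⟨
  ℚ.toℚᵘ (+ m / 1) ℚᵘ.+ ℚ.toℚᵘ (+ n / 1)
    ≈⟨ ℚ.toℚᵘ-homo-+ (+ m / 1) (+ n / 1) ⟨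
  ℚ.toℚᵘ (+ m / 1 + + n / 1) ∎)
  where
  open ℚᵘ.≃-Reasoning
  ι : ℕ → ℚᵘ.ℚᵘ
  ι i = ℚᵘ.mkℚᵘ (+ i) 0

-- Lists without repetitions

module _ {A B : Set} where

  -- Blocks of distinct elements are disjoint, since `key` recovers from an entry the block it came
  -- from.
  unique-concatMap : (h : A → List B) (key : B → A) → ∀ {xs} → Unique xs →
                     (∀ {x} → x ∈ xs → Unique (h x)) →
                     (∀ {x y} → x ∈ xs → y ∈ h x → key y ≡ x) →
                     Unique (concatMap h xs)
  unique-concatMap h key [] uh keyed = []
  unique-concatMap h key {x ∷ xs} (x∉ ∷ u) uh keyed =
    Unique.++⁺ (uh (here refl))
      (unique-concatMap h key u (uh ∘ there) (keyed ∘ there))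
      λ { (y∈ , y∈′) → disjoint y∈ (∈-concat⁻′ (map h xs) y∈′) }
    where
    disjoint : ∀ {y} → y ∈ h x → ¬ (∃ λ ys → y ∈ ys × ys ∈ map h xs)
    disjoint y∈ (_ , y∈′ , ys∈) with ∈-map⁻ h ys∈
    ... | x′ , x′∈ , refl =
      All.lookup x∉ x′∈ (trans (sym (keyed (here refl) y∈)) (keyed (there x′∈) y∈′))

  -- The left inverse is asked for on the list only: `merge c` is inverted by `split` only on
  -- suitable routes.
  unique-map : (f : A → B) (f⁻¹ : B → A) → ∀ {xs} → Unique xs →
               (∀ {x} → x ∈ xs → f⁻¹ (f x) ≡ x) → Unique (map f xs)
  unique-map f f⁻¹ []       inv = []
  unique-map f f⁻¹ (x∉ ∷ u) inv =
    All.map⁺ (All.tabulate (λ y∈ fx≡fy → All.lookup x∉ y∈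
      (trans (sym (inv (here refl))) (trans (cong f⁻¹ fx≡fy) (inv (there y∈))))))
    ∷ unique-map f f⁻¹ u (inv ∘ there)

unique∧set⇒length : ∀ {A : Set} {xs ys : List A} → Unique xs → Unique ys →
                    (∀ {x} → x ∈ xs ⇔ x ∈ ys) → length xs ≡ length ys
unique∧set⇒length u v e = ↭-length (∼bag⇒↭ (unique∧set⇒bag u v e))

module Occurrences {A : Set} (_≟_ : DecidableEquality A) where

  δ : A → A → ℕ
  δ a b = if does (a ≟ b) then 1 else 0

  δ-refl : ∀ a → δ a a ≡ 1
  δ-refl a = cong (if_then 1 else 0) (dec-true (a ≟ a) refl)

  δ-≢ : ∀ {a b} → a ≢ b → δ a b ≡ 0
  δ-≢ {a} {b} a≢b = cong (if_then 1 else 0) (dec-false (a ≟ b) a≢b)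

  occ : A → List A → ℕ
  occ a []       = 0
  occ a (x ∷ xs) = δ a x ℕ.+ occ a xs

  -- Self-avoidance and full coverage become one condition on multiplicities, which passes through
  -- `split` by plain recursion.
  EveryOnce : List A → Set
  EveryOnce xs = ∀ a → occ a xs ≡ 1

  occ-∉ : ∀ {a xs} → a ∉ xs → occ a xs ≡ 0
  occ-∉ {xs = []}     a∉ = refl
  occ-∉ {xs = x ∷ xs} a∉ = cong₂ ℕ._+_ (δ-≢ (a∉ ∘ here)) (occ-∉ (a∉ ∘ there))

  occ-unique : ∀ {a xs} → Unique xs → a ∈ xs → occ a xs ≡ 1
  occ-unique {a} (x∉ ∷ u) (here refl) =
    cong₂ ℕ._+_ (δ-refl a) (occ-∉ (λ a∈ → All.lookup x∉ a∈ refl))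
  occ-unique (x∉ ∷ u) (there a∈) =
    cong₂ ℕ._+_ (δ-≢ (λ { refl → All.lookup x∉ a∈ refl })) (occ-unique u a∈)

  occ-∈ : ∀ {a} xs → 0 < occ a xs → a ∈ xs
  occ-∈ {a} (x ∷ xs) 0<occ with a ≟ x
  ... | yes refl = here refl
  ... | no  _    = there (occ-∈ xs 0<occ)

  unique-occ : ∀ xs → (∀ a → occ a xs ≤ 1) → Unique xs
  unique-occ []       occ≤1 = []
  unique-occ (x ∷ xs) occ≤1 =
    All.tabulate (λ {y} y∈ → λ { refl → ℕ.<-irrefl refl
      (ℕ.≤-trans (ℕ.≤-reflexive (sym (cong₂ ℕ._+_ (δ-refl x) (occ-unique u y∈)))) (occ≤1 x)) })
    ∷ u
    where u = unique-occ xs (λ a → ℕ.≤-trans (ℕ.m≤n+m _ _) (occ≤1 a))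

  everyOnce⇔ : ∀ {xs} → EveryOnce xs ⇔ (Unique xs × ∀ a → a ∈ xs)
  everyOnce⇔ {xs} = mk⇔
    (λ once → unique-occ xs (ℕ.≤-reflexive ∘ once) ,
              λ a → occ-∈ xs (ℕ.≤-reflexive (sym (once a))))
    (λ (u , all) a → occ-unique u (all a))

module Fins {m : ℕ} = Occurrences (Fin._≟_ {m})
module Vertices {m n : ℕ} = Occurrences (_≟ᵛ_ {m} {n})

δ-⇔ : ∀ {A B : Set} (_≟₁_ : DecidableEquality A) (_≟₂_ : DecidableEquality B) {a b c d} →
      (a ≡ b ⇔ c ≡ d) → Occurrences.δ _≟₁_ a b ≡ Occurrences.δ _≟₂_ c d
δ-⇔ _≟₁_ _≟₂_ {a} {b} {c} {d} e = cong (if_then 1 else 0) (does-⇔ e (a ≟₁ b) (c ≟₂ d))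

-- Cutting off the first column

-- Writing `toℕ j ≡ 0` instead of `zero` expresses the first column for every width `n`, including
-- 0.
adjacent-right : ∀ {m n} (r : Fin m) {j : Fin n} → toℕ j ≡ 0 →
                 Adjacent {m} {suc n} (r , zero) (r , suc j)
adjacent-right r {zero} _ rewrite ℕ.∣n-n∣≡0 (toℕ r) = refl

adjacent-left : ∀ {m n} (r : Fin m) {j : Fin n} → toℕ j ≡ 0 →
                Adjacent {m} {suc n} (r , suc j) (r , zero)
adjacent-left r {zero} _ rewrite ℕ.∣n-n∣≡0 (toℕ r) = refl

-- The second square is at least 1, so it uses up the whole sum. Hence only horizontal edges cross
-- between columns.
squares-1 : ∀ d m → d ℕ.^ 2 ℕ.+ suc m ℕ.^ 2 ≡ 1 → d ≡ 0 × m ≡ 0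
squares-1 zero    zero    _ = refl , refl
squares-1 (suc d) m       e = contradiction
  (ℕ.m+n≡0⇒n≡0 (d ℕ.* 1 ℕ.+ d ℕ.* suc (d ℕ.* 1)) {suc m ℕ.^ 2} (ℕ.suc-injective e)) λ ()
squares-1 zero    (suc m) ()

adjacent-right⁻¹ : ∀ {m n} (r s : Fin m) (j : Fin n) →
                   Adjacent {m} {suc n} (r , zero) (s , suc j) → r ≡ s × toℕ j ≡ 0
adjacent-right⁻¹ r s j e with squares-1 ℕ.∣ toℕ r - toℕ s ∣ (toℕ j) e
... | d≡0 , j≡0 = Fin.toℕ-injective (ℕ.∣m-n∣≡0⇒m≡n d≡0) , j≡0

adjacent-left⁻¹ : ∀ {m n} (r s : Fin m) (j : Fin n) →
                  Adjacent {m} {suc n} (r , suc j) (s , zero) → r ≡ s × toℕ j ≡ 0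
adjacent-left⁻¹ r s j e with squares-1 ℕ.∣ toℕ r - toℕ s ∣ (toℕ j) e
... | d≡0 , j≡0 = Fin.toℕ-injective (ℕ.∣m-n∣≡0⇒m≡n d≡0) , j≡0

data Move : Set where
  stay detour : Move

-- Route systems and their interfaces

module Height (k : ℕ) where

  Row : Set
  Row = Fin (suc k)

  -- A sequence of walks; nothing marks the end of each of them, so a tour w is
  -- the route closed w below.
  Route : ℕ → Set
  Route n = List (Maybe (Vertex (suc k) n))

  -- The first column's share of a route. Each token records the next vertex
  -- (or end mark) belonging to the first column; detour says that a maximal
  -- excursion into the other columns precedes it.
  ColumnRoute : Set
  ColumnRoute = List (Move × Maybe Row)

  -- For each walk of a route, the row of the first column where it starts and
  -- the row of the first column where it has to end (nothing: anywhere).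
  Interface : Set
  Interface = List (Row × Maybe Row)

  EndsAt : ∀ {n} → Vertex (suc k) n → Maybe Row → Set
  EndsAt (r , c) e = e ≡ nothing ⊎ e ≡ just r × toℕ c ≡ 0

  data Realizes {n : ℕ} : Interface → Route n → Set
  data Continues {n : ℕ} : Vertex (suc k) n → Maybe Row → Interface → Route n → Set

  data Realizes {n} where
    []    : Realizes [] []
    start : ∀ {r c e b w} → toℕ c ≡ 0 → Continues (r , c) e b w →
            Realizes ((r , e) ∷ b) (just (r , c) ∷ w)

  data Continues {n} where
    step : ∀ {v u e b w} → Adjacent v u → Continues u e b w → Continues v e b (just u ∷ w)
    stop : ∀ {v e b w} → EndsAt v e → Realizes b w → Continues v e b (nothing ∷ w)

  -- `leave` forgets the inside of an excursion; `ColumnResumes` reads the recorded token, which is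
  -- either the row of return or the end of the walk outside the column. The latter is compatible
  -- only with a free end.
  data ColumnRealizes : Interface → ColumnRoute → Set
  data ColumnContinues : Row → Maybe Row → Interface → ColumnRoute → Set
  data ColumnResumes : Maybe Row → Maybe Row → Interface → ColumnRoute → Set

  data ColumnRealizes where
    []    : ColumnRealizes [] []
    start : ∀ {r e b c} → ColumnContinues r e b c →
            ColumnRealizes ((r , e) ∷ b) ((stay , just r) ∷ c)

  data ColumnContinues where
    step  : ∀ {r s e b c} → Adjacent {n = 1} (r , zero) (s , zero) → ColumnContinues s e b c →
            ColumnContinues r e b ((stay , just s) ∷ c)
    stop  : ∀ {r e b c} → EndsAt {n = 1} (r , zero) e → ColumnRealizes b c →
            ColumnContinues r e b ((stay , nothing) ∷ c)
    leave : ∀ {r t e b c} → ColumnResumes t e b c → ColumnContinues r e b ((detour , t) ∷ c)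

  data ColumnResumes where
    back : ∀ {r e b c} → ColumnContinues r e b c → ColumnResumes (just r) e b c
    end  : ∀ {b c} → ColumnRealizes b c → ColumnResumes nothing nothing b c

  -- Decidability and lengths of column routes

  columnRealizes? : ∀ b c → Dec (ColumnRealizes b c)
  columnContinues? : ∀ r e b c → Dec (ColumnContinues r e b c)
  columnResumes? : ∀ t e b c → Dec (ColumnResumes t e b c)

  columnRealizes? []            []      = yes []
  columnRealizes? []            (_ ∷ _) = no λ ()
  columnRealizes? (_ ∷ _)       []      = no λ ()
  columnRealizes? (_ ∷ _)       ((detour , _) ∷ _)       = no λ ()
  columnRealizes? (_ ∷ _)       ((stay , nothing) ∷ _)   = no λ ()
  columnRealizes? ((r , e) ∷ b) ((stay , just s) ∷ c) =
    map′ (λ { (refl , l) → start l }) (λ { (start l) → refl , l })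
         (r Fin.≟ s ×-dec columnContinues? s e b c)

  columnContinues? r e b [] = no λ ()
  columnContinues? r e b ((stay , just s) ∷ c) =
    map′ (λ (a , l) → step a l) (λ { (step a l) → a , l })
         (_ ℕ.≟ _ ×-dec columnContinues? s e b c)
  columnContinues? r e b ((stay , nothing) ∷ c) =
    map′ (λ (a , l) → stop a l) (λ { (stop a l) → a , l })
         ((Maybe.≡-dec Fin._≟_ e nothing ⊎-dec Maybe.≡-dec Fin._≟_ e (just r) ×-dec 0 ℕ.≟ 0)
           ×-dec columnRealizes? b c)
  columnContinues? r e b ((detour , t) ∷ c) =
    map′ leave (λ { (leave l) → l }) (columnResumes? t e b c)

  columnResumes? (just r) e        b c = map′ back (λ { (back l) → l }) (columnContinues? r e b c)
  columnResumes? nothing  nothing  b c = map′ end (λ { (end l) → l }) (columnRealizes? b c)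
  columnResumes? nothing  (just _) b c = no λ ()

  rows : ColumnRoute → List Row
  rows c = catMaybes (map proj₂ c)

  -- The interface of the excursions of c, where r is the current row (junk
  -- before the start of a walk).
  excursions : Row → ColumnRoute → Interface
  excursions r []                 = []
  excursions r ((stay , t) ∷ c)   = excursions (fromMaybe r t) c
  excursions r ((detour , t) ∷ c) = (r , t) ∷ excursions (fromMaybe r t) c

  -- Each excursion is preceded by a first-column vertex of its own, which is
  -- why finitely many interfaces suffice for a given height.
  length-excursions : ∀ {b c} r → ColumnRealizes b c →
                      length (excursions r c) ≤ length (rows c)
  length-excursions′ : ∀ {r e b c} → ColumnContinues r e b c →
                       length (excursions r c) ≤ suc (length (rows c))

  length-excursions r []        = z≤n
  length-excursions r (start l) = length-excursions′ l

  length-excursions′ (step _ l)       = ℕ.≤-trans (length-excursions′ l) (ℕ.n≤1+n _)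
  length-excursions′ (stop _ l)       = ℕ.≤-trans (length-excursions _ l) (ℕ.n≤1+n _)
  length-excursions′ (leave (back l)) = s≤s (length-excursions′ l)
  length-excursions′ (leave (end l))  = s≤s (length-excursions _ l)

  -- Each token carries a row or is the end mark of one of the walks; a walk in progress still owes
  -- its mark. This fixes the word length in `columns`.
  length-column : ∀ {b c} → ColumnRealizes b c → length c ≡ length (rows c) ℕ.+ length b
  length-column′ : ∀ {r e b c} → ColumnContinues r e b c →
                   length c ≡ length (rows c) ℕ.+ suc (length b)

  length-column []        = refl
  length-column (start l) = cong suc (length-column′ l)

  length-column′ (step _ l) = cong suc (length-column′ l)
  length-column′ {b = b} {c = _ ∷ c} (stop _ l) =
    trans (cong suc (length-column l)) (sym (ℕ.+-suc (length (rows c)) (length b)))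
  length-column′ (leave (back l)) = cong suc (length-column′ l)
  length-column′ {b = b} {c = _ ∷ c} (leave (end l)) =
    trans (cong suc (length-column l)) (sym (ℕ.+-suc (length (rows c)) (length b)))

  -- Merging and splitting routes

  merge : ∀ {n} → ColumnRoute → Route n → Route (suc n)
  mergeDetour : ∀ {n} → Maybe Row → ColumnRoute → Route n → Route (suc n)

  merge []                 w = []
  merge ((stay , t) ∷ c)   w = Maybe.map (_, zero) t ∷ merge c w
  merge ((detour , t) ∷ c) w = mergeDetour t c w

  -- Junk value: an excursion always carries its end mark.
  mergeDetour t c []                  = []
  mergeDetour t c (just (r , j) ∷ w) = just (r , suc j) ∷ mergeDetour t c w
  -- The end mark of the excursion gives way to the token at which the walk resumes or ends.
  mergeDetour t c (nothing ∷ w)      = Maybe.map (_, zero) t ∷ merge c w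

  -- A `detour` token needs its target before the excursion has been read, so `splitDetour` returns
  -- it separately. A return to the first column also closes the excursion with a new end mark.
  split : ∀ {n} → Route (suc n) → ColumnRoute × Route n
  splitDetour : ∀ {n} → Route (suc n) → Maybe Row × ColumnRoute × Route n

  split [] = [] , []
  split (nothing ∷ w)            = let c , w′ = split w in (stay , nothing) ∷ c , w′
  split (just (r , zero) ∷ w)  = let c , w′ = split w in (stay , just r) ∷ c , w′
  split (just (r , suc j) ∷ w) =
    let t , c , w′ = splitDetour w in (detour , t) ∷ c , just (r , j) ∷ w′

  splitDetour [] = nothing , [] , []
  splitDetour (nothing ∷ w)            = let c , w′ = split w in nothing , c , nothing ∷ w′
  splitDetour (just (r , zero) ∷ w)  = let c , w′ = split w in just r , c , nothing ∷ w′
  splitDetour (just (r , suc j) ∷ w) =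
    let t , c , w′ = splitDetour w in t , c , just (r , j) ∷ w′

  -- The pieces fit because the induced interface makes each excursion start in the row just left
  -- and end in the row of return, where horizontal edges join the columns.
  merge-realizes : ∀ {n b c} r {w : Route n} → ColumnRealizes b c →
                   Realizes (excursions r c) w → Realizes b (merge c w)
  merge-continues : ∀ {n r e b c} {w : Route n} → ColumnContinues r e b c →
                    Realizes (excursions r c) w → Continues (r , zero) e b (merge c w)
  merge-resumes : ∀ {n t e b c r s j} {w : Route n} → ColumnResumes t e b c →
                  Continues (s , j) t (excursions (fromMaybe r t) c) w →
                  Continues (s , suc j) e b (mergeDetour t c w)

  merge-realizes r []        ρ = []
  merge-realizes r (start l) ρ = start refl (merge-continues l ρ)

  merge-continues (step a l) ρ = step a (merge-continues l ρ)
  merge-continues (stop x l) ρ = stop x (merge-realizes _ l ρ)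
  merge-continues (leave l) (start {r} j≡0 ω) =
    step (adjacent-right r j≡0) (merge-resumes l ω)

  merge-resumes l (step {u = _ , _} a ω) = step a (merge-resumes l ω)
  merge-resumes (back {r} l) (stop (inj₂ (refl , j≡0)) ρ) =
    step (adjacent-left r j≡0) (merge-continues l ρ)
  merge-resumes (end l) (stop _ ρ) = stop (inj₁ refl) (merge-realizes _ l ρ)

  -- The end marks that `merge` drops are recovered from the column indices, since vertices of
  -- excursions are moved to columns `suc j`.
  split-merge : ∀ {n b c} r {w : Route n} → ColumnRealizes b c →
                Realizes (excursions r c) w → split (merge c w) ≡ (c , w)
  split-merge′ : ∀ {n r e b c} {w : Route n} → ColumnContinues r e b c →
                 Realizes (excursions r c) w → split (merge c w) ≡ (c , w)
  splitDetour-merge : ∀ {n t e b c r v} {w : Route n} → ColumnResumes t e b c →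
                      Continues v t (excursions (fromMaybe r t) c) w →
                      splitDetour (mergeDetour t c w) ≡ (t , c , w)

  split-merge r []        [] = refl
  split-merge r (start l) ρ rewrite split-merge′ l ρ = refl

  split-merge′ (step _ l) ρ rewrite split-merge′ l ρ = refl
  split-merge′ (stop _ l) ρ rewrite split-merge _ l ρ = refl
  split-merge′ (leave l) (start _ ω) rewrite splitDetour-merge l ω = refl

  splitDetour-merge l (step {u = _ , _} _ ω) rewrite splitDetour-merge l ω = refl
  splitDetour-merge (back l) (stop _ ρ) rewrite split-merge′ l ρ = refl
  splitDetour-merge (end l)  (stop _ ρ) rewrite split-merge _ l ρ = refl

  -- Walks start in the first column and cross out of it only along horizontal edges, so each
  -- excursion obeys the interface read off from its neighbours in that column.
  split-realizes : ∀ {n b} r {w : Route (suc n)} → Realizes b w → let c , w′ = split w in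
                   ColumnRealizes b c × Realizes (excursions r c) w′ × merge c w′ ≡ w
  split-continues : ∀ {n r e b} {w : Route (suc n)} → Continues (r , zero) e b w →
                    let c , w′ = split w in
                    ColumnContinues r e b c × Realizes (excursions r c) w′ × merge c w′ ≡ w
  split-resumes : ∀ {n e b s j} r {w : Route (suc n)} → Continues (s , suc j) e b w →
                  let t , c , w′ = splitDetour w in
                  ColumnResumes t e b c ×
                  Continues (s , j) t (excursions (fromMaybe r t) c) w′ × mergeDetour t c w′ ≡ w

  split-realizes r [] = [] , [] , refl
  split-realizes r (start {c = zero} _ ω) with split-continues ω
  ... | l , ρ , e = start l , ρ , cong (_ ∷_) e

  split-continues (step {u = _ , zero} a ω) with split-continues ω
  ... | l , ρ , e = step a l , ρ , cong (_ ∷_) e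
  split-continues {r = r} (step {u = s , suc j} a ω) with adjacent-right⁻¹ r s j a
  ... | refl , j≡0 with split-resumes _ ω
  ... | l , ω′ , e = leave l , start j≡0 ω′ , cong (_ ∷_) e
  split-continues (stop x ρ) with split-realizes _ ρ
  ... | l , ρ′ , e = stop x l , ρ′ , cong (_ ∷_) e

  split-resumes {s = s} {j} r (step {u = s′ , zero} a ω) with adjacent-left⁻¹ s s′ j a
  ... | refl , j≡0 with split-continues ω
  ... | l , ρ , e = back l , stop (inj₂ (refl , j≡0)) ρ , cong (_ ∷_) e
  split-resumes r (step {u = _ , suc _} a ω) with split-resumes r ω
  ... | l , ω′ , e = l , step a ω′ , cong (_ ∷_) e
  -- A prescribed end is impossible here, because the walk stops in a column `suc j`.
  split-resumes r (stop (inj₁ refl) ρ) with split-realizes r ρ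
  ... | l , ρ′ , e = end l , stop (inj₁ refl) ρ′ , cong (_ ∷_) e

  -- Vertex multiplicities under splitting

  δ-column : ∀ {n} (r s : Row) → Vertices.δ {n = suc n} (r , zero) (s , zero) ≡ Fins.δ r s
  δ-column r s = δ-⇔ _≟ᵛ_ Fin._≟_ {r , zero} {s , zero} (mk⇔ (cong proj₁) (cong (_, zero)))

  δ-rest : ∀ {n} (r s : Row) (i j : Fin n) →
           Vertices.δ (r , suc i) (s , suc j) ≡ Vertices.δ (r , i) (s , j)
  δ-rest r s i j = δ-⇔ _≟ᵛ_ _≟ᵛ_ {r , suc i} {s , suc j} {r , i} {s , j}
    (mk⇔ (λ { refl → refl }) (λ { refl → refl }))

  occ-column : ∀ {n} r (w : Route (suc n)) →
               Vertices.occ (r , zero) (catMaybes w) ≡ Fins.occ r (rows (proj₁ (split w)))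
  occ-column′ : ∀ {n} r (w : Route (suc n)) → let t , c , _ = splitDetour w in
                Vertices.occ (r , zero) (catMaybes w) ≡ Fins.occ r (catMaybes (t ∷ map proj₂ c))

  occ-column r []            = refl
  occ-column r (nothing ∷ w) = occ-column r w
  occ-column r (just (s , zero) ∷ w) =
    cong₂ ℕ._+_ (δ-column r s) (occ-column r w)
  occ-column r (just (s , suc j) ∷ w) =
    cong₂ ℕ._+_ (Vertices.δ-≢ {a = r , zero} {b = s , suc j} λ ()) (occ-column′ r w)

  occ-column′ r []            = refl
  occ-column′ r (nothing ∷ w) = occ-column r w
  occ-column′ r (just (s , zero) ∷ w) =
    cong₂ ℕ._+_ (δ-column r s) (occ-column r w)
  occ-column′ r (just (s , suc j) ∷ w) =
    cong₂ ℕ._+_ (Vertices.δ-≢ {a = r , zero} {b = s , suc j} λ ()) (occ-column′ r w)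

  occ-rest : ∀ {n} r (i : Fin n) (w : Route (suc n)) →
             Vertices.occ (r , suc i) (catMaybes w) ≡
             Vertices.occ (r , i) (catMaybes (proj₂ (split w)))
  occ-rest′ : ∀ {n} r (i : Fin n) (w : Route (suc n)) →
              Vertices.occ (r , suc i) (catMaybes w) ≡
              Vertices.occ (r , i) (catMaybes (proj₂ (proj₂ (splitDetour w))))

  occ-rest r i []            = refl
  occ-rest r i (nothing ∷ w) = occ-rest r i w
  occ-rest r i (just (s , zero) ∷ w) =
    cong₂ ℕ._+_ (Vertices.δ-≢ {a = r , suc i} {b = s , zero} λ ()) (occ-rest r i w)
  occ-rest r i (just (s , suc j) ∷ w) =
    cong₂ ℕ._+_ (δ-rest r s i j) (occ-rest′ r i w)

  occ-rest′ r i []            = refl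
  occ-rest′ r i (nothing ∷ w) = occ-rest r i w
  occ-rest′ r i (just (s , zero) ∷ w) =
    cong₂ ℕ._+_ (Vertices.δ-≢ {a = r , suc i} {b = s , zero} λ ()) (occ-rest r i w)
  occ-rest′ r i (just (s , suc j) ∷ w) =
    cong₂ ℕ._+_ (δ-rest r s i j) (occ-rest′ r i w)

  everyOnce-split⇔ : ∀ {n} (w : Route (suc n)) →
    Vertices.EveryOnce (catMaybes w) ⇔
    (Fins.EveryOnce (rows (proj₁ (split w))) × Vertices.EveryOnce (catMaybes (proj₂ (split w))))
  everyOnce-split⇔ w = mk⇔
    (λ once → (λ r → trans (sym (occ-column r w)) (once (r , zero))) ,
              (λ (r , i) → trans (sym (occ-rest r i w)) (once (r , suc i))))
    (λ { (once₁ , once₂) (r , zero)  → trans (occ-column r w) (once₁ r)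
       ; (once₁ , once₂) (r , suc i) → trans (occ-rest r i w) (once₂ (r , i)) })

  -- Enumeration of column coverings

  maybeRows : List (Maybe Row)
  maybeRows = nothing ∷ map just (allFin (suc k))

  ∈-maybeRows : ∀ t → t ∈ maybeRows
  ∈-maybeRows nothing  = here refl
  ∈-maybeRows (just r) = there (∈-map⁺ just (∈-allFin r))

  maybeRows-unique : Unique maybeRows
  maybeRows-unique =
    All.map⁺ (All.tabulate (λ _ ())) ∷ Unique.map⁺ Maybe.just-injective (Unique.allFin⁺ (suc k))

  moves : List Move
  moves = stay ∷ detour ∷ []

  tokens : List (Move × Maybe Row)
  tokens = cartesianProduct moves maybeRows

  ∈-tokens : ∀ x → x ∈ tokens
  ∈-tokens (stay   , t) = ∈-cartesianProduct⁺ {xs = moves} (here refl) (∈-maybeRows t)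
  ∈-tokens (detour , t) = ∈-cartesianProduct⁺ {xs = moves} (there (here refl)) (∈-maybeRows t)

  tokens-unique : Unique tokens
  tokens-unique =
    Unique.cartesianProduct⁺ (((λ ()) ∷ []) ∷ [] ∷ []) maybeRows-unique

  CoversColumn : Interface → ColumnRoute → Set
  CoversColumn b c = ColumnRealizes b c × Fins.EveryOnce (rows c)

  coversColumn? : ∀ b c → Dec (CoversColumn b c)
  coversColumn? b c = columnRealizes? b c ×-dec Fin.all? (λ r → Fins.occ r (rows c) ℕ.≟ 1)

  columns : Interface → List ColumnRoute
  columns b = filter (coversColumn? b) (words tokens (suc k ℕ.+ length b))

  length-rows : ∀ {c} → Fins.EveryOnce (rows c) → length (rows c) ≡ suc k
  length-rows {c} once = trans
    (unique∧set⇒length {xs = rows c} u (Unique.allFin⁺ (suc k))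
      (mk⇔ (λ _ → ∈-allFin _) (λ _ → all _)))
    (List.length-tabulate {n = suc k} (λ i → i))
    where
    u = proj₁ (Equivalence.to (Fins.everyOnce⇔ {xs = rows c}) once)
    all = proj₂ (Equivalence.to (Fins.everyOnce⇔ {xs = rows c}) once)

  ∈-columns : ∀ {b c} → c ∈ columns b ⇔ CoversColumn b c
  ∈-columns {b} {c} = mk⇔
    (λ c∈ → proj₂ (∈-filter⁻ (coversColumn? b) {xs = words tokens (suc k ℕ.+ length b)} c∈))
    (λ (l , once) → ∈-filter⁺ (coversColumn? b)
      (subst (λ m → c ∈ words tokens m)
        (trans (length-column l) (cong (ℕ._+ length b) (length-rows {c} once)))
        (∈-words ∈-tokens c))
      (l , once))

  columns-unique : ∀ b → Unique (columns b)
  columns-unique b =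
    Unique.filter⁺ (coversColumn? b) (words-unique tokens-unique (suc k ℕ.+ length b))

  -- Enumeration of route systems, column by column

  Covers : ∀ {n} → Interface → Route n → Set
  Covers b w = Realizes b w × Vertices.EveryOnce (catMaybes w)

  extend : ∀ {n} → (Interface → List (Route n)) → ColumnRoute → List (Route (suc n))
  extend ws c = map (merge c) (ws (excursions zero c))

  routes : ∀ n → Interface → List (Route n)
  routes zero    []      = [] ∷ []
  routes zero    (_ ∷ _) = []
  routes (suc n) b       = concatMap (extend (routes n)) (columns b)

  routes⇒covers : ∀ n b {w} → w ∈ routes n b → Covers b w
  routes⇒covers zero [] (here refl) = [] , λ ()
  routes⇒covers (suc n) b w∈ with ∈-concat⁻′ (map (extend (routes n)) (columns b)) w∈
  ... | _ , w∈ws , ws∈ with ∈-map⁻ (extend (routes n)) ws∈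
  ... | c , c∈ , refl with ∈-map⁻ (merge c) w∈ws | Equivalence.to ∈-columns c∈
  ... | w′ , w′∈ , refl | l , once with routes⇒covers n (excursions zero c) w′∈
  ... | ρ , once′ = merge-realizes zero l ρ ,
        Equivalence.from (everyOnce-split⇔ (merge c w′))
          (subst (λ (c , w) → Fins.EveryOnce (rows c) × Vertices.EveryOnce (catMaybes w))
            (sym (split-merge zero l ρ)) (once , once′))

  covers⇒routes : ∀ n b {w} → Covers b w → w ∈ routes n b
  covers⇒routes zero [] ([] , _) = here refl
  covers⇒routes (suc n) b {w} (ρ , once)
    with split w | split-realizes zero ρ | Equivalence.to (everyOnce-split⇔ w) once
  ... | c , w′ | l , ρ′ , refl | once₁ , once₂ =
    ∈-concat⁺′ (∈-map⁺ (merge c) (covers⇒routes n (excursions zero c) (ρ′ , once₂)))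
               (∈-map⁺ (extend (routes n)) (Equivalence.from ∈-columns (l , once₁)))

  split-extend : ∀ n b {c w} → c ∈ columns b → w ∈ routes n (excursions zero c) →
                 split (merge c w) ≡ (c , w)
  split-extend n b {c} c∈ w∈ = split-merge zero (proj₁ (Equivalence.to ∈-columns c∈))
    (proj₁ (routes⇒covers n (excursions zero c) w∈))

  -- `split` undoes both levels of the construction: its first component identifies the block, its
  -- second inverts `merge c` within the block.
  routes-unique : ∀ n b → Unique (routes n b)
  routes-unique zero    []      = [] ∷ []
  routes-unique zero    (_ ∷ _) = []
  routes-unique (suc n) b       = unique-concatMap
    (extend (routes n)) (proj₁ ∘ split) (columns-unique b)
    (λ {c} c∈ → unique-map (merge c) (proj₂ ∘ split) (routes-unique n (excursions zero c))
      (λ w∈ → cong proj₂ (split-extend n b c∈ w∈)))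
    (λ {c} c∈ w∈ → key c∈ (∈-map⁻ (merge c) w∈))
    where
    key : ∀ {c w} → c ∈ columns b →
          (∃ λ w′ → w′ ∈ routes n (excursions zero c) × w ≡ merge c w′) → proj₁ (split w) ≡ c
    key c∈ (_ , w′∈ , refl) = cong proj₁ (split-extend n b c∈ w′∈)

  -- Tours as systems of a single walk

  closed : ∀ {n} → List (Vertex (suc k) n) → Route n
  closed w = map just w ∷ʳ nothing

  closed-injective : ∀ {n} {w w′ : List (Vertex (suc k) n)} → closed w ≡ closed w′ → w ≡ w′
  closed-injective e = List.map-injective Maybe.just-injective (List.∷ʳ-injectiveˡ _ _ e)

  catMaybes-closed : ∀ {n} (w : List (Vertex (suc k) n)) → catMaybes (closed w) ≡ w
  catMaybes-closed []      = refl
  catMaybes-closed (v ∷ w) = cong (v ∷_) (catMaybes-closed w)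

  linked⇒continues : ∀ {n v} {w : List (Vertex (suc k) n)} → Linked Adjacent (v ∷ w) →
                     Continues v nothing [] (closed w)
  linked⇒continues [-]     = stop (inj₁ refl) []
  linked⇒continues (a ∷ l) = step a (linked⇒continues l)

  continues⇒linked : ∀ {n v} {x : Route n} → Continues v nothing [] x →
                     ∃ λ w → Linked Adjacent (v ∷ w) × x ≡ closed w
  continues⇒linked (stop _ []) = [] , [-] , refl
  continues⇒linked (step {u = u} a ω) with continues⇒linked ω
  ... | w , l , refl = u ∷ w , a ∷ l , refl

  fromCorner : Interface
  fromCorner = (zero , nothing) ∷ []

  tour⇒covers : ∀ {n} {w : List (Vertex (suc k) (suc n))} → IsGreekKeyTour w →
                Covers fromCorner (closed w)
  tour⇒covers {w = v ∷ w} (isGreekKeyTour refl l u all) =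
    start refl (linked⇒continues l) ,
    subst Vertices.EveryOnce (sym (catMaybes-closed (v ∷ w)))
      (Equivalence.from Vertices.everyOnce⇔ (u , all))

  covers⇒tour : ∀ {n} {x : Route (suc n)} → Covers fromCorner x →
                ∃ λ w → IsGreekKeyTour w × x ≡ closed w
  covers⇒tour (start {c = zero} _ ω , once) with continues⇒linked ω
  ... | w , l , refl with Equivalence.to Vertices.everyOnce⇔
                            (subst Vertices.EveryOnce (catMaybes-closed (corner ∷ w)) once)
  ... | u , all = corner ∷ w , isGreekKeyTour refl l u all , refl

  -- `closed` maps the tours bijectively onto the systems covering the grid for `fromCorner`, and
  -- both sides are listed without repetition.
  g-routes : ∀ n → g (suc k) (suc n) ≡ length (routes (suc n) fromCorner)
  g-routes n = trans (sym (List.length-map closed (greekKeyTours (suc k) (suc n))))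
    (unique∧set⇒length (Unique.map⁺ closed-injective greekKeyTours-unique)
      (routes-unique (suc n) fromCorner)
      (mk⇔ (λ x∈ → to (∈-map⁻ closed x∈))
           (λ x∈ → from (covers⇒tour (routes⇒covers (suc n) fromCorner x∈)))))
    where
    to : ∀ {x} → (∃ λ w → w ∈ greekKeyTours (suc k) (suc n) × x ≡ closed w) →
         x ∈ routes (suc n) fromCorner
    to (_ , w∈ , refl) =
      covers⇒routes (suc n) fromCorner (tour⇒covers (Equivalence.to ∈-greekKeyTours w∈))
    from : ∀ {x} → (∃ λ w → IsGreekKeyTour w × x ≡ closed w) →
           x ∈ map closed (greekKeyTours (suc k) (suc n))
    from (_ , t , refl) = ∈-map⁺ closed (Equivalence.from ∈-greekKeyTours t)

  -- Finiteness of the interfaces and closure under the shift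

  interfaces : List Interface
  -- Lengths run from 0 up to and including the height `suc k`.
  interfaces = concatMap (words (cartesianProduct (allFin (suc k)) maybeRows)) (upTo (suc (suc k)))

  ∈-interfaces : ∀ {b} → length b ≤ suc k → b ∈ interfaces
  ∈-interfaces {b} b≤ = ∈-concat⁺′
    (∈-words (λ (r , t) → ∈-cartesianProduct⁺ (∈-allFin r) (∈-maybeRows t)) b)
    (∈-map⁺ (words (cartesianProduct (allFin (suc k)) maybeRows)) (∈-upTo⁺ (s≤s b≤)))

  excursions∈interfaces : ∀ {b c} → c ∈ columns b → excursions zero c ∈ interfaces
  excursions∈interfaces {b} {c} c∈ with Equivalence.to ∈-columns c∈
  ... | l , once = ∈-interfaces
    (ℕ.≤-trans (length-excursions zero l) (ℕ.≤-reflexive (length-rows {c} once)))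

  count : Interface → PowerSeries
  count b n = + length (routes n b) / 1

  -- `G` is a separate generator: at width 0 it is 1 by convention, whereas `count fromCorner` is 0
  -- there. Their shifts agree.
  basis : List PowerSeries
  basis = G (suc k) ∷ map count interfaces

  -- A column contributes to width `suc n` as many systems as its induced interface has at width
  -- `n`, so every column adds one count with coefficient 1.
  extensions-span : ∀ cs → (∀ {c} → c ∈ cs → excursions zero c ∈ interfaces) →
                    Span basis (λ n → + length (concatMap (extend (routes n)) cs) / 1)
  extensions-span []       cs⊆ = null (λ _ → refl)
  extensions-span (c ∷ cs) cs⊆ = comb 1ℚ
    (extensions-span cs (cs⊆ ∘ there))
    (gen (there (∈-map⁺ count (cs⊆ (here refl)))))
    λ n → let ws = routes n (excursions zero c); zs = concatMap (extend (routes n)) cs in begin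
      + length (map (merge c) ws ++ zs) / 1
        ≡⟨ cong (λ m → + m / 1) (List.length-++ (map (merge c) ws)) ⟩
      + (length (map (merge c) ws) ℕ.+ length zs) / 1
        ≡⟨ cong (λ m → + (m ℕ.+ length zs) / 1) (List.length-map (merge c) ws) ⟩
      + (length ws ℕ.+ length zs) / 1
        ≡⟨ cong (λ m → + m / 1) (ℕ.+-comm (length ws) (length zs)) ⟩
      + (length zs ℕ.+ length ws) / 1
        ≡⟨ /1-homo-+ (length zs) (length ws) ⟩
      + length zs / 1 + + length ws / 1
        ≡⟨ cong (λ x → + length zs / 1 + x) (sym (ℚ.*-identityˡ (+ length ws / 1))) ⟩
      + length zs / 1 + 1ℚ * (+ length ws / 1) ∎
    where open ≡-Reasoning

  -- The bound on induced interfaces depends on the height only, so it holds whatever the length of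
  -- `b`.
  count-span : ∀ b → Span basis (shift (count b))
  count-span b = extensions-span (columns b) excursions∈interfaces

  basis-closed : ∀ {f} → f ∈ basis → Span basis (shift f)
  basis-closed (here refl) = span-resp (count-span fromCorner)
    (λ n → cong (λ m → + m / 1) (g-routes n))
  basis-closed (there f∈) with ∈-map⁻ count f∈
  ... | b , _ , refl = count-span b

theorem7p1 : (k : ℕ) .{{_ : NonZero k}} → IsRational (G k)
theorem7p1 (suc k) = shiftClosed⇒rational basis-closed (here refl)
  where open Height k
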